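{- Let $T$ be a rooted tree with two levels of descendants whose root has $n\geqslant 2$ children $a_1,\dotsc,a_n$, and for each $i\in\{1,\dotsc,n\}$ let $l_i\geqslant 0$ be the number of children of $a_i$. Let $l:=\left|\{i\in\{1,\dotsc,n\}: l_i=2\}\right|$. Then $T$ is not $d$-balanced if and only if $l=\frac{n-1}{2}$ and $l_i\in\{0,2\}$ for each $i\in\{1,\dotsc,n\}$.
   Context: For a simple undirected finite graph $G$ and $v\in V(G)$, the closed neighborhood is $N_G[v]=\{u\in V(G): uv\in E(G)\}\cup\{v\}$. A function $f\colon V(G)\to\{ -1,0,1\}$ is a balanced domination function (BDF) on $G$ if $\sum_{u\in N_G[v]} f(u)=0$ for every $v\in V(G)$. Its weight is $\omega_f=\sum_{v\in V(G)} f(v)$. The balanced domination number $\gamma_{bd}(G)$ is the maximum of $\omega_f$ over all BDFs $f$ on $G$. The graph $G$ is called $d$-balanced if $\gamma_{bd}(G)=0$. A rooted tree $T$ with two levels of descendants has a root vertex $a_0$, whose children are $a_1,\dotsc,a_n$; each $a_i$ ($1\leqslant i\leqslant n$) has $l_i$ children, denoted $a_{i,1},\dotsc,a_{i,l_i}$ if $l_i\geqslant 1$; and the vertices $a_{i,j}$ have no children. The edges of $T$ are exactly the edges $a_0a_i$ and $a_ia_{i,j}$. -}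

module Defs where

open import Data.Fin.Base using (Fin)
import Data.Fin.Properties as Fin
open import Data.Integer.Base as ℤ using (ℤ; 0ℤ; 1ℤ; -1ℤ)
open import Data.List.Base using (List; _∷_; _++_; map; filter; foldr; allFin; concatMap; length)
open import Data.List.Membership.Propositional using (_∈_)
open import Data.List.Membership.Propositional.Properties
  using (∈-map⁺; ∈-map⁻; ∈-++⁺ˡ; ∈-++⁺ʳ; ∈-++⁻; ∈-concat⁺′; ∈-concat⁻′; ∈-allFin)
open import Data.List.Relation.Unary.Any using (here; there)
import Data.List.Relation.Unary.All.Properties as All
import Data.List.Relation.Unary.All as AllBase
import Data.List.Relation.Unary.AllPairs as AllPairsBase
import Data.List.Relation.Unary.AllPairs.Properties as AllPairs
open import Data.List.Relation.Unary.AllPairs using (_∷_)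
open import Data.List.Relation.Binary.Disjoint.Propositional using (Disjoint)
open import Data.List.Relation.Unary.Unique.Propositional using (Unique)
import Data.List.Relation.Unary.Unique.Propositional.Properties as Unique
open import Data.Nat.Base using (ℕ)
import Data.Nat.Properties as ℕ
open import Data.Product.Base using (_×_; _,_; ∃-syntax)
open import Data.Sum.Base using (_⊎_; inj₁; inj₂)
open import Level using (0ℓ)
open import Relation.Binary.Core using (Rel)
open import Relation.Binary.Construct.Closure.Symmetric as SymClosure
  using (SymClosure; fwd; bwd)
open import Relation.Binary.Definitions
  using (Decidable; DecidableEquality; Symmetric; Irreflexive)
open import Relation.Binary.PropositionalEquality using (_≡_; _≢_; refl)
open import Relation.Nullary.Decidable using (yes; no; map′; _⊎-dec_)

record Graph : Set₁ where
  field
    V               : Set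
    _≟_             : DecidableEquality V
    vertices        : List V
    vertices-all    : ∀ v → v ∈ vertices
    vertices-unique : Unique vertices
    E               : Rel V 0ℓ
    E?              : Decidable E
    E-sym           : Symmetric E
    E-irrefl        : Irreflexive _≡_ E

  N[_] : V → List V
  N[ v ] = filter (λ u → E? u v ⊎-dec (u ≟ v)) vertices

∑ : {A : Set} → List A → (A → ℤ) → ℤ
∑ xs f = foldr ℤ._+_ 0ℤ (map f xs)

module _ (G : Graph) where
  open Graph G

  record IsBDF (f : V → ℤ) : Set where
    field
      values   : ∀ v → f v ≡ -1ℤ ⊎ f v ≡ 0ℤ ⊎ f v ≡ 1ℤ
      balanced : ∀ v → ∑ N[ v ] f ≡ 0ℤ

  weight : (V → ℤ) → ℤ
  weight f = ∑ vertices f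

  -- γ is the maximum weight of a BDF. There are finitely many BDFs and the
  -- zero function is one, so every graph has exactly one such γ.
  record IsBalancedDominationNumber (γ : ℤ) : Set where
    field
      attained   : ∃[ f ] IsBDF f × weight f ≡ γ
      upperBound : ∀ f → IsBDF f → weight f ℤ.≤ γ

  DBalanced : Set
  DBalanced = IsBalancedDominationNumber 0ℤ

-- The vertices a₀, aᵢ and aᵢⱼ of the tree in which aᵢ has l i children.
data TreeVertex {n : ℕ} (l : Fin n → ℕ) : Set where
  root  : TreeVertex l
  child : Fin n → TreeVertex l
  leaf  : (i : Fin n) → Fin (l i) → TreeVertex l

module _ {n : ℕ} {l : Fin n → ℕ} where

  data ParentOf : Rel (TreeVertex l) 0ℓ where
    root-child : ∀ i → ParentOf root (child i)
    child-leaf : ∀ i j → ParentOf (child i) (leaf i j)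

  TreeEdge : Rel (TreeVertex l) 0ℓ
  TreeEdge = SymClosure ParentOf

  _≟ᵗ_ : DecidableEquality (TreeVertex l)
  root     ≟ᵗ root      = yes refl
  root     ≟ᵗ child _   = no λ ()
  root     ≟ᵗ leaf _ _  = no λ ()
  child _  ≟ᵗ root      = no λ ()
  child i  ≟ᵗ child k   with i Fin.≟ k
  ... | yes refl = yes refl
  ... | no i≢k   = no λ { refl → i≢k refl }
  child _  ≟ᵗ leaf _ _  = no λ ()
  leaf _ _ ≟ᵗ root      = no λ ()
  leaf _ _ ≟ᵗ child _   = no λ ()
  leaf i j ≟ᵗ leaf k m  with i Fin.≟ k
  ... | no i≢k   = no λ { refl → i≢k refl }
  ... | yes refl with j Fin.≟ m
  ...   | yes refl = yes refl
  ...   | no j≢m   = no λ { refl → j≢m refl }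

  parentOf? : Decidable ParentOf
  parentOf? root       root       = no λ ()
  parentOf? root       (child i)  = yes (root-child i)
  parentOf? root       (leaf _ _) = no λ ()
  parentOf? (child _)  root       = no λ ()
  parentOf? (child _)  (child _)  = no λ ()
  parentOf? (child i)  (leaf k j) with i Fin.≟ k
  ... | yes refl = yes (child-leaf i j)
  ... | no i≢k   = no λ { (child-leaf _ _) → i≢k refl }
  parentOf? (leaf _ _) _          = no λ ()

  treeEdge? : Decidable TreeEdge
  treeEdge? u v = map′ (λ { (inj₁ p) → fwd p ; (inj₂ p) → bwd p })
                       (λ { (fwd p) → inj₁ p ; (bwd p) → inj₂ p })
                       (parentOf? u v ⊎-dec parentOf? v u)

  treeEdge-irrefl : Irreflexive _≡_ TreeEdge
  treeEdge-irrefl refl (fwd ())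
  treeEdge-irrefl refl (bwd ())

  leavesOf : Fin n → List (TreeVertex l)
  leavesOf i = map (leaf i) (allFin (l i))

  childList leafList treeVertices : List (TreeVertex l)
  childList    = map child (allFin n)
  leafList     = concatMap leavesOf (allFin n)
  treeVertices = root ∷ childList ++ leafList

  treeVertices-all : ∀ v → v ∈ treeVertices
  treeVertices-all root       = here refl
  treeVertices-all (child i)  = there (∈-++⁺ˡ (∈-map⁺ child (∈-allFin i)))
  treeVertices-all (leaf i j) = there (∈-++⁺ʳ childList
    (∈-concat⁺′ (∈-map⁺ (leaf i) (∈-allFin j)) (∈-map⁺ leavesOf (∈-allFin i))))

  private
    ∈-leafList⁻ : ∀ {v} → v ∈ leafList → ∃[ i ] ∃[ j ] v ≡ leaf i j
    ∈-leafList⁻ v∈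
      with _ , v∈xs , xs∈ ← ∈-concat⁻′ (map leavesOf (allFin n)) v∈
      with i , _ , refl ← ∈-map⁻ leavesOf xs∈
      with j , _ , eq ← ∈-map⁻ (leaf i) v∈xs
      = i , j , eq

    root∉ : ∀ {v} → v ∈ childList ++ leafList → root ≢ v
    root∉ v∈ refl with ∈-++⁻ childList v∈
    ... | inj₁ p with () ← ∈-map⁻ child p
    ... | inj₂ p with () ← ∈-leafList⁻ p

    childList-leafList-disjoint : Disjoint childList leafList
    childList-leafList-disjoint (p , q)
      with _ , _ , refl ← ∈-map⁻ child p
      with () ← ∈-leafList⁻ q

    leavesOf-disjoint : ∀ {i k} → i ≢ k → Disjoint (leavesOf i) (leavesOf k)
    leavesOf-disjoint i≢k (p , q)
      with _ , _ , refl ← ∈-map⁻ (leaf _) p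
      with _ , _ , refl ← ∈-map⁻ (leaf _) q
      = i≢k refl

    leafList-unique : Unique leafList
    leafList-unique = Unique.concat⁺
      (All.map⁺ (AllBase.universal
        (λ i → Unique.map⁺ (λ { refl → refl }) (Unique.allFin⁺ (l i))) (allFin n)))
      (AllPairs.map⁺ (AllPairsBase.map leavesOf-disjoint (Unique.allFin⁺ n)))

  treeVertices-unique : Unique treeVertices
  treeVertices-unique =
    AllBase.tabulate root∉ ∷
    Unique.++⁺ (Unique.map⁺ (λ { refl → refl }) (Unique.allFin⁺ n))
               leafList-unique childList-leafList-disjoint

tree : (n : ℕ) → (Fin n → ℕ) → Graph
tree n l = record
  { V               = TreeVertex l
  ; _≟_             = _≟ᵗ_
  ; vertices        = treeVertices
  ; vertices-all    = treeVertices-all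
  ; vertices-unique = treeVertices-unique
  ; E               = TreeEdge
  ; E?              = treeEdge?
  ; E-sym           = SymClosure.symmetric ParentOf
  ; E-irrefl        = treeEdge-irrefl
  }

#twos : ∀ {n} → (Fin n → ℕ) → ℕ
#twos {n} l = length (filter (λ i → l i ℕ.≟ 2) (allFin n))

{-# OPTIONS --safe #-}
-- Let f be a BDF with value r at the root. A leaf takes minus the value of its
-- parent, so the condition at aᵢ reads (lᵢ − 1) f(aᵢ) = r; summing the
-- conditions at a₁, …, aₙ gives weight (1 − n) r. Hence T is not d-balanced iff
-- some BDF has r = −1. Then lᵢ ∈ {0, 2} and f(aᵢ) = 1 − lᵢ = ±1, and the
-- condition at the root becomes n − 2l = 1; conversely these values define a BDF.
module Submission where

open import Defs
open import Data.Fin.Base using (Fin)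
open import Data.Integer.Base using (+_; _-_)
open import Data.Nat.Base using (ℕ; _≥_)
open import Data.Product.Base using (_×_)
open import Data.Rational.Unnormalised.Base using (_/_; _≃_)
open import Data.Sum.Base using (_⊎_)
open import Function.Bundles using (_⇔_)
open import Relation.Binary.PropositionalEquality using (_≡_)
open import Relation.Nullary.Negation using (¬_)

open import Algebra.Bundles using (CommutativeMonoid)
import Data.Fin.Properties as Fin
open import Data.Integer.Base as ℤ using (ℤ; 0ℤ; 1ℤ; -1ℤ; _+_; _*_; -_)
import Data.Integer.Properties as ℤ
open import Data.Integer.Tactic.RingSolver using (solve-∀)
open import Data.List.Base using (List; []; _∷_; _++_; map; filter; concatMap; length; allFin)
open import Data.List.Membership.Propositional using (_∈_)
open import Data.List.Membership.Propositional.Properties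
  using (∈-map⁺; ∈-map⁻; ∈-filter⁺; ∈-filter⁻; ∈-allFin)
open import Data.List.Membership.Propositional.Properties.WithK using (unique∧set⇒bag)
open import Data.List.Properties using (length-tabulate; filter-accept; filter-reject)
open import Data.List.Relation.Binary.BagAndSetEquality using (∼bag⇒↭)
open import Data.List.Relation.Binary.Permutation.Propositional using (_↭_; ↭⇒↭ₛ)
import Data.List.Relation.Binary.Permutation.Propositional.Properties as Perm
open import Data.List.Relation.Binary.Permutation.Setoid.Properties using (foldr-commMonoid)
import Data.List.Relation.Unary.All as All
open import Data.List.Relation.Unary.AllPairs using ([]; _∷_)
open import Data.List.Relation.Unary.Any using (here; there)
open import Data.List.Relation.Unary.Unique.Propositional using (Unique)
import Data.List.Relation.Unary.Unique.Propositional.Properties as Unique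
import Data.Nat.Base as ℕ
import Data.Nat.Properties as ℕ
open import Data.Product.Base using (_,_; proj₂)
open import Data.Rational.Unnormalised.Base using (*≡*)
import Data.Rational.Unnormalised.Properties as ℚᵘ
open import Data.Sum.Base using (inj₁; inj₂)
open import Function.Base using (_∘_)
open import Function.Bundles using (mk⇔)
open import Relation.Binary.Construct.Closure.Symmetric using (fwd; bwd)
open import Relation.Binary.PropositionalEquality
  using (refl; sym; trans; cong; cong₂; subst; module ≡-Reasoning)
open import Relation.Nullary.Decidable using (Dec; decidable-stable; _×-dec_; _⊎-dec_)
open import Relation.Nullary.Negation using (contradiction)

open ≡-Reasoning

-- Integer sums over lists, and an integer equation for the value at a child.

∑-cong : {A : Set} (xs : List A) {f g : A → ℤ} → (∀ x → f x ≡ g x) → ∑ xs f ≡ ∑ xs g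
∑-cong []       f≗g = refl
∑-cong (x ∷ xs) f≗g = cong₂ _+_ (f≗g x) (∑-cong xs f≗g)

∑-++ : {A : Set} (xs ys : List A) (f : A → ℤ) → ∑ (xs ++ ys) f ≡ ∑ xs f + ∑ ys f
∑-++ []       ys f = sym (ℤ.+-identityˡ _)
∑-++ (x ∷ xs) ys f = trans (cong (_+_ (f x)) (∑-++ xs ys f)) (sym (ℤ.+-assoc (f x) _ _))

∑-map : {A B : Set} (h : A → B) (xs : List A) (f : B → ℤ) → ∑ (map h xs) f ≡ ∑ xs (f ∘ h)
∑-map h []       f = refl
∑-map h (x ∷ xs) f = cong (_+_ (f (h x))) (∑-map h xs f)

∑-concatMap : {A B : Set} (h : A → List B) (xs : List A) (f : B → ℤ) →
  ∑ (concatMap h xs) f ≡ ∑ xs (λ x → ∑ (h x) f)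
∑-concatMap h []       f = refl
∑-concatMap h (x ∷ xs) f =
  trans (∑-++ (h x) (concatMap h xs) f) (cong (_+_ (∑ (h x) f)) (∑-concatMap h xs f))

∑-+ : {A : Set} (xs : List A) (f g : A → ℤ) → ∑ xs (λ x → f x + g x) ≡ ∑ xs f + ∑ xs g
∑-+ []       f g = refl
∑-+ (x ∷ xs) f g = trans (cong (_+_ (f x + g x)) (∑-+ xs f g)) (interchange (f x) (g x) _ _)
  where
  interchange : ∀ a b c d → (a + b) + (c + d) ≡ (a + c) + (b + d)
  interchange = solve-∀

∑-const : {A : Set} (xs : List A) (c : ℤ) → ∑ xs (λ _ → c) ≡ + length xs * c
∑-const []       c = sym (ℤ.*-zeroˡ c)
∑-const (x ∷ xs) c = trans (cong (_+_ c) (∑-const xs c)) (sym (ℤ.suc-* (+ length xs) c))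

∑-allFin-const : ∀ n c → ∑ (allFin n) (λ _ → c) ≡ + n * c
∑-allFin-const n c =
  trans (∑-const (allFin n) c) (cong (λ k → + k * c) (length-tabulate {n = n} (λ i → i)))

∑-zero : {A : Set} (xs : List A) → ∑ xs (λ _ → 0ℤ) ≡ 0ℤ
∑-zero xs = trans (∑-const xs 0ℤ) (ℤ.*-zeroʳ (+ length xs))

-- Integer addition is commutative, so a sum over a closed neighbourhood may be taken over any
-- enumeration of it.
∑-↭ : {A : Set} {xs ys : List A} (f : A → ℤ) → xs ↭ ys → ∑ xs f ≡ ∑ ys f
∑-↭ f xs↭ys =
  foldr-commMonoid ℤ-+-0.setoid ℤ-+-0.isCommutativeMonoid (↭⇒↭ₛ (Perm.map⁺ f xs↭ys))
  where module ℤ-+-0 = CommutativeMonoid ℤ.+-0-commutativeMonoid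

-- Here `c` is the value at a child with `m` leaves when the root has value -1. The equation says (1
-- - m) c = 1, so `c` is a unit and equals 1 - m.
sign-equation : ∀ {c} m → c ≡ -1ℤ ⊎ c ≡ 0ℤ ⊎ c ≡ 1ℤ → -1ℤ + (c + + m * - c) ≡ 0ℤ →
  (m ≡ 0 ⊎ m ≡ 2) × c ≡ 1ℤ - + m
sign-equation m (inj₁ refl) eq = inj₂ m≡2 , cong (λ k → 1ℤ - + k) (sym m≡2)
  where
  rearrange : ∀ x → x ≡ (-1ℤ + (-1ℤ + x * 1ℤ)) + (+ 2)
  rearrange = solve-∀
  m≡2 : m ≡ 2
  m≡2 = ℤ.+-injective (trans (rearrange (+ m)) (cong (_+ (+ 2)) eq))
sign-equation m (inj₂ (inj₁ refl)) eq
  -- For `c` = 0 the product with `m` vanishes and the equation becomes -1 = 0.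
  with () ← trans (cong (λ x → -1ℤ + (0ℤ + x)) (sym (ℤ.*-zeroʳ (+ m)))) eq
sign-equation m (inj₂ (inj₂ refl)) eq = inj₁ m≡0 , cong (λ k → 1ℤ - + k) (sym m≡0)
  where
  rearrange : ∀ x → x ≡ - (-1ℤ + (1ℤ + x * -1ℤ))
  rearrange = solve-∀
  m≡0 : m ≡ 0
  m≡0 = ℤ.+-injective (trans (rearrange (+ m)) (cong -_ eq))

-- Closed neighbourhoods in the tree and the sums over them.

module _ {n : ℕ} {l : Fin n → ℕ} where

  open Graph (tree n l) using (N[_])

  -- An explicit enumeration on which sums compute; `N[_]` filters the list of all vertices and does
  -- not reduce for variable `n` and `l`.
  neighbourhood : TreeVertex l → List (TreeVertex l)
  neighbourhood root       = root ∷ childList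
  neighbourhood (child i)  = root ∷ child i ∷ leavesOf i
  neighbourhood (leaf i j) = child i ∷ leaf i j ∷ []

  neighbourhood-unique : ∀ v → Unique (neighbourhood v)
  neighbourhood-unique root =
    All.tabulate (λ u∈ → λ { refl → root∉childList u∈ })
      ∷ Unique.map⁺ (λ { refl → refl }) (Unique.allFin⁺ n)
    where
    root∉childList : ¬ (root ∈ childList {l = l})
    root∉childList p with () ← ∈-map⁻ child p
  neighbourhood-unique (child i) =
    ((λ ()) All.∷ All.tabulate (λ u∈ → λ { refl → root∉leavesOf u∈ }))
      ∷ All.tabulate (λ u∈ → λ { refl → child∉leavesOf u∈ })
      ∷ Unique.map⁺ (λ { refl → refl }) (Unique.allFin⁺ (l i))
    where
    root∉leavesOf : ¬ (root ∈ leavesOf {l = l} i)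
    root∉leavesOf p with () ← ∈-map⁻ (leaf i) p
    child∉leavesOf : ¬ (child i ∈ leavesOf {l = l} i)
    child∉leavesOf p with () ← ∈-map⁻ (leaf i) p
  neighbourhood-unique (leaf i j) = ((λ ()) All.∷ All.[]) ∷ All.[] ∷ []

  ∈-neighbourhood⁺ : ∀ {u} v → TreeEdge u v ⊎ u ≡ v → u ∈ neighbourhood v
  ∈-neighbourhood⁺ root       (inj₁ (bwd (root-child i)))   = there (∈-map⁺ child (∈-allFin i))
  ∈-neighbourhood⁺ root       (inj₂ refl)                   = here refl
  ∈-neighbourhood⁺ (child i)  (inj₁ (fwd (root-child i)))   = here refl
  ∈-neighbourhood⁺ (child i)  (inj₁ (bwd (child-leaf i j))) = there (there (∈-map⁺ (leaf i) (∈-allFin j)))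
  ∈-neighbourhood⁺ (child i)  (inj₂ refl)                   = there (here refl)
  ∈-neighbourhood⁺ (leaf i j) (inj₁ (fwd (child-leaf i j))) = here refl
  ∈-neighbourhood⁺ (leaf i j) (inj₂ refl)                   = there (here refl)

  ∈-neighbourhood⁻ : ∀ {u} v → u ∈ neighbourhood v → TreeEdge u v ⊎ u ≡ v
  ∈-neighbourhood⁻ root       (here refl) = inj₂ refl
  ∈-neighbourhood⁻ root       (there p)
    with i , _ , refl ← ∈-map⁻ child p    = inj₁ (bwd (root-child i))
  ∈-neighbourhood⁻ (child i)  (here refl) = inj₁ (fwd (root-child i))
  ∈-neighbourhood⁻ (child i)  (there (here refl)) = inj₂ refl
  ∈-neighbourhood⁻ (child i)  (there (there p))
    with j , _ , refl ← ∈-map⁻ (leaf i) p = inj₁ (bwd (child-leaf i j))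
  ∈-neighbourhood⁻ (leaf i j) (here refl) = inj₁ (fwd (child-leaf i j))
  ∈-neighbourhood⁻ (leaf i j) (there (here refl)) = inj₂ refl

  -- Two duplicate-free lists with the same members are equal as bags, hence permutations of each
  -- other. This avoids evaluating the filter.
  N↭neighbourhood : ∀ v → N[ v ] ↭ neighbourhood v
  N↭neighbourhood v = ∼bag⇒↭ (unique∧set⇒bag
    (Unique.filter⁺ adjacent? treeVertices-unique)
    (neighbourhood-unique v)
    (mk⇔ (∈-neighbourhood⁺ v ∘ proj₂ ∘ ∈-filter⁻ adjacent? {xs = treeVertices})
         (∈-filter⁺ adjacent? (treeVertices-all _) ∘ ∈-neighbourhood⁻ v)))
    where
    adjacent? : ∀ u → Dec (TreeEdge u v ⊎ u ≡ v)
    adjacent? u = treeEdge? u v ⊎-dec (u ≟ᵗ v)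

  ∑-N-root : ∀ f → ∑ N[ root ] f ≡ f root + ∑ (allFin n) (f ∘ child)
  ∑-N-root f = trans (∑-↭ f (N↭neighbourhood root)) (cong (_+_ (f root)) (∑-map child (allFin n) f))

  ∑-N-child : ∀ f i → ∑ N[ child i ] f ≡ f root + (f (child i) + ∑ (leavesOf i) f)
  ∑-N-child f i = ∑-↭ f (N↭neighbourhood (child i))

  ∑-N-leaf : ∀ f i j → ∑ N[ leaf i j ] f ≡ f (child i) + f (leaf i j)
  ∑-N-leaf f i j =
    trans (∑-↭ f (N↭neighbourhood (leaf i j))) (cong (_+_ (f (child i))) (ℤ.+-identityʳ _))

  ∑-leavesOf : ∀ f i c → (∀ j → f (leaf i j) ≡ c) → ∑ (leavesOf i) f ≡ + l i * c
  ∑-leavesOf f i c f≡c = begin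
    ∑ (leavesOf i) f                   ≡⟨ ∑-map (leaf i) (allFin (l i)) f ⟩
    ∑ (allFin (l i)) (f ∘ leaf i)      ≡⟨ ∑-cong (allFin (l i)) f≡c ⟩
    ∑ (allFin (l i)) (λ _ → c)         ≡⟨ ∑-allFin-const (l i) c ⟩
    + l i * c                          ∎

  weight-split : ∀ f → weight (tree n l) f ≡
    f root + (∑ (allFin n) (f ∘ child) + ∑ (allFin n) (λ i → ∑ (leavesOf i) f))
  weight-split f = cong (_+_ (f root)) (trans (∑-++ childList leafList f)
    (cong₂ _+_ (∑-map child (allFin n) f) (∑-concatMap leavesOf (allFin n) f)))

  -- Consequences of the balance conditions at children and leaves.

  module _ {f : TreeVertex l → ℤ} (bdf : IsBDF (tree n l) f) where

    open IsBDF bdf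

    -- The closed neighbourhoods of the children together contain the root `n` times and every other
    -- vertex exactly once, so adding their balance conditions determines the weight.
    weight-BDF : weight (tree n l) f ≡ f root - + n * f root
    weight-BDF = begin
      weight (tree n l) f                         ≡⟨ weight-split f ⟩
      f root + (C + L)                            ≡⟨ rearrange (f root) (+ n * f root) (C + L) ⟩
      (+ n * f root + (C + L)) + (f root - + n * f root)
                                                  ≡⟨ cong (_+ (f root - + n * f root)) children-balanced ⟩
      0ℤ + (f root - + n * f root)                ≡⟨ ℤ.+-identityˡ _ ⟩
      f root - + n * f root                       ∎
      where
      C L : ℤ
      C = ∑ (allFin n) (f ∘ child)
      L = ∑ (allFin n) (λ i → ∑ (leavesOf i) f)

      rearrange : ∀ r m s → r + s ≡ (m + s) + (r - m)
      rearrange = solve-∀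

      children-balanced : + n * f root + (C + L) ≡ 0ℤ
      children-balanced = begin
        + n * f root + (C + L)
          ≡⟨ cong₂ _+_ (∑-allFin-const n (f root)) (∑-+ (allFin n) (f ∘ child) _) ⟨
        ∑ (allFin n) (λ _ → f root) + ∑ (allFin n) (λ i → f (child i) + ∑ (leavesOf i) f)
          ≡⟨ ∑-+ (allFin n) (λ _ → f root) _ ⟨
        ∑ (allFin n) (λ i → f root + (f (child i) + ∑ (leavesOf i) f))
          ≡⟨ ∑-cong (allFin n) (λ i → trans (sym (∑-N-child f i)) (balanced (child i))) ⟩
        ∑ (allFin n) (λ _ → 0ℤ)
          ≡⟨ ∑-zero (allFin n) ⟩
        0ℤ ∎

    -- The closed neighbourhood of a leaf is the leaf and its parent, so each of the `l i` leaves
    -- carries the value opposite to that of the child.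
    child-balanced : ∀ i → f root + (f (child i) + + l i * - f (child i)) ≡ 0ℤ
    child-balanced i = begin
      f root + (f (child i) + + l i * - f (child i))
        ≡⟨ cong (λ s → f root + (f (child i) + s)) (∑-leavesOf f i _ leaf-value) ⟨
      f root + (f (child i) + ∑ (leavesOf i) f)
        ≡⟨ ∑-N-child f i ⟨
      ∑ N[ child i ] f
        ≡⟨ balanced (child i) ⟩
      0ℤ ∎
      where
      leaf-value : ∀ j → f (leaf i j) ≡ - f (child i)
      leaf-value j = begin
        f (leaf i j)                                  ≡⟨ rearrange (f (child i)) _ ⟩
        (f (child i) + f (leaf i j)) + - f (child i)
          ≡⟨ cong (_+ - f (child i)) (trans (sym (∑-N-leaf f i j)) (balanced (leaf i j))) ⟩
        0ℤ + - f (child i)                            ≡⟨ ℤ.+-identityˡ _ ⟩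
        - f (child i)                                 ∎
        where
        rearrange : ∀ a b → b ≡ (a + b) + - a
        rearrange = solve-∀

    child-value : f root ≡ -1ℤ → ∀ i → (l i ≡ 0 ⊎ l i ≡ 2) × f (child i) ≡ 1ℤ - + l i
    child-value r≡-1 i = sign-equation (l i) (values (child i))
      (subst (λ r → r + (f (child i) + + l i * - f (child i)) ≡ 0ℤ) r≡-1 (child-balanced i))

-- The balance condition at the root, and the BDFs with value -1 there.

∑-zeroOrTwo : ∀ {n} (l : Fin n → ℕ) → (∀ i → l i ≡ 0 ⊎ l i ≡ 2) → (is : List (Fin n)) →
  ∑ is (λ i → 1ℤ - + l i) ≡ + length is - + length (filter (λ i → l i ℕ.≟ 2) is) * + 2
∑-zeroOrTwo l l∈02 []       = refl
∑-zeroOrTwo l l∈02 (i ∷ is) with l∈02 i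
-- A child without leaves adds 1 to the sum and 1 to the length, and the filter drops it.
... | inj₁ l≡0
    rewrite filter-reject (λ i → l i ℕ.≟ 2) {i} {is} (λ l≡2 → ℕ.0≢1+n (trans (sym l≡0) l≡2))
          | l≡0 | ∑-zeroOrTwo l l∈02 is
    = step (+ length is) (+ length (filter (λ i → l i ℕ.≟ 2) is) * + 2)
  where
  step : ∀ m t → 1ℤ + (m - t) ≡ (1ℤ + m) - t
  step = solve-∀
-- A child with two leaves adds 1 - 2 = -1 to the sum; both lengths grow by 1, and the filtered one
-- is subtracted twice.
... | inj₂ l≡2
    rewrite filter-accept (λ i → l i ℕ.≟ 2) {i} {is} l≡2
          | l≡2 | ∑-zeroOrTwo l l∈02 is
    = step (+ length is) (+ length (filter (λ i → l i ℕ.≟ 2) is))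
  where
  step : ∀ m t → -1ℤ + (m - t * + 2) ≡ (1ℤ + m) - (1ℤ + t) * + 2
  step = solve-∀

∑-children : ∀ {n} (l : Fin n → ℕ) → (∀ i → l i ≡ 0 ⊎ l i ≡ 2) →
  ∑ (allFin n) (λ i → 1ℤ - + l i) ≡ + n - + #twos l * + 2
∑-children {n} l l∈02 = trans (∑-zeroOrTwo l l∈02 (allFin n))
  (cong (λ m → + m - + #twos l * + 2) (length-tabulate {n = n} (λ i → i)))

-- The fraction is rational because n - 1 may be odd. Unfolding `≃` cross-multiplies it to the
-- integer equation `+ #twos l * + 2 ≡ (+ n - 1ℤ) * 1ℤ`, which explains the factor `1ℤ` in the
-- proofs below.
HalfTwos : (n : ℕ) → (Fin n → ℕ) → Set
HalfTwos n l = ((+ #twos l) / 1 ≃ (+ n - + 1) / 2) × (∀ i → l i ≡ 0 ⊎ l i ≡ 2)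

halfTwos? : ∀ n l → Dec (HalfTwos n l)
halfTwos? n l = (_ ℚᵘ.≃? _) ×-dec Fin.all? (λ i → (l i ℕ.≟ 0) ⊎-dec (l i ℕ.≟ 2))

rootNegative⇒halfTwos : ∀ {n} {l : Fin n → ℕ} {f} → IsBDF (tree n l) f →
  f root ≡ -1ℤ → HalfTwos n l
rootNegative⇒halfTwos {n} {l} {f} bdf r≡-1 = *≡* (begin
    + #twos l * + 2                     ≡⟨ rearrange (+ n) (+ #twos l * + 2) ⟩
    -- The subtracted bracket is the sum of `f` over the closed neighbourhood of the root, which
    -- vanishes.
    (+ n - 1ℤ) * 1ℤ - (-1ℤ + (+ n - + #twos l * + 2))
                                        ≡⟨ cong (_-_ ((+ n - 1ℤ) * 1ℤ)) root-balanced ⟩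
    (+ n - 1ℤ) * 1ℤ - 0ℤ                ≡⟨ ℤ.+-identityʳ _ ⟩
    (+ n - 1ℤ) * 1ℤ                     ∎) , l∈02
  where
  open IsBDF bdf
  l∈02 : ∀ i → l i ≡ 0 ⊎ l i ≡ 2
  l∈02 i = let z , _ = child-value bdf r≡-1 i in z

  rearrange : ∀ m t → t ≡ (m - 1ℤ) * 1ℤ - (-1ℤ + (m - t))
  rearrange = solve-∀

  root-balanced : -1ℤ + (+ n - + #twos l * + 2) ≡ 0ℤ
  root-balanced = begin
    -1ℤ + (+ n - + #twos l * + 2)             ≡⟨ cong₂ _+_ r≡-1 (∑-children l l∈02) ⟨
    f root + ∑ (allFin n) (λ i → 1ℤ - + l i)
      ≡⟨ cong (_+_ (f root)) (∑-cong (allFin n) (λ i → proj₂ (child-value bdf r≡-1 i))) ⟨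
    f root + ∑ (allFin n) (f ∘ child)         ≡⟨ ∑-N-root f ⟨
    ∑ (Graph.N[_] (tree n l) root) f          ≡⟨ balanced root ⟩
    0ℤ                                        ∎

-- These are the values that `child-value` and the leaf conditions force on a BDF with value -1 at
-- the root.
extremal : ∀ {n} (l : Fin n → ℕ) → TreeVertex l → ℤ
extremal l root       = -1ℤ
extremal l (child i)  = 1ℤ - + l i
extremal l (leaf i j) = - (1ℤ - + l i)

extremal-isBDF : ∀ {n} {l : Fin n → ℕ} → HalfTwos n l → IsBDF (tree n l) (extremal l)
extremal-isBDF {n} {l} (*≡* half , l∈02) = record { values = values ; balanced = balanced }
  where
  values : ∀ v → extremal l v ≡ -1ℤ ⊎ extremal l v ≡ 0ℤ ⊎ extremal l v ≡ 1ℤ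
  values root = inj₁ refl
  values (child i) with l i | l∈02 i
  ... | _ | inj₁ refl = inj₂ (inj₂ refl)
  ... | _ | inj₂ refl = inj₁ refl
  values (leaf i j) with l i | l∈02 i
  ... | _ | inj₁ refl = inj₁ refl
  ... | _ | inj₂ refl = inj₂ (inj₂ refl)

  -- The left side equals (1 - l i)² - 1, whose zeros are 0 and 2.
  child-condition : ∀ i → -1ℤ + ((1ℤ - + l i) + + l i * - (1ℤ - + l i)) ≡ 0ℤ
  child-condition i with l i | l∈02 i
  ... | _ | inj₁ refl = refl
  ... | _ | inj₂ refl = refl

  balanced : ∀ v → ∑ (Graph.N[_] (tree n l) v) (extremal l) ≡ 0ℤ
  balanced root = begin
    ∑ (Graph.N[_] (tree n l) root) (extremal l) ≡⟨ ∑-N-root (extremal l) ⟩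
    -1ℤ + ∑ (allFin n) (λ i → 1ℤ - + l i)     ≡⟨ cong (_+_ -1ℤ) (∑-children l l∈02) ⟩
    -1ℤ + (+ n - + #twos l * + 2)             ≡⟨ cong (λ t → -1ℤ + (+ n - t)) half ⟩
    -1ℤ + (+ n - (+ n - 1ℤ) * 1ℤ)             ≡⟨ cancel (+ n) ⟩
    0ℤ                                        ∎
    where
    cancel : ∀ m → -1ℤ + (m - (m - 1ℤ) * 1ℤ) ≡ 0ℤ
    cancel = solve-∀
  balanced (child i) = begin
    ∑ (Graph.N[_] (tree n l) (child i)) (extremal l)
      ≡⟨ ∑-N-child (extremal l) i ⟩
    -1ℤ + ((1ℤ - + l i) + ∑ (leavesOf i) (extremal l))
      ≡⟨ cong (λ s → -1ℤ + ((1ℤ - + l i) + s)) (∑-leavesOf (extremal l) i _ (λ _ → refl)) ⟩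
    -1ℤ + ((1ℤ - + l i) + + l i * - (1ℤ - + l i))
      ≡⟨ child-condition i ⟩
    0ℤ ∎
  balanced (leaf i j) =
    trans (∑-N-leaf (extremal l) i j) (ℤ.+-inverseʳ (1ℤ - + l i))

-- From BDFs to the balanced domination number.

zero-isBDF : ∀ G → IsBDF G (λ _ → 0ℤ)
zero-isBDF G = record
  { values   = λ _ → inj₂ (inj₁ refl)
  ; balanced = λ v → ∑-zero (Graph.N[_] G v)
  }

-- The zero function attains weight 0. A BDF with root value r has weight (1 - n) r, which is at
-- most 0 for r = 0 and r = 1; the remaining value r = -1 would give `HalfTwos`.
¬halfTwos⇒dBalanced : ∀ {n} {l : Fin n → ℕ} → n ≥ 1 → ¬ HalfTwos n l → DBalanced (tree n l)
¬halfTwos⇒dBalanced {n} {l} n≥1 ¬half = record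
  { attained   = (λ _ → 0ℤ) , zero-isBDF (tree n l) , ∑-zero (treeVertices {l = l})
  ; upperBound = upperBound
  }
  where
  upperBound : ∀ f → IsBDF (tree n l) f → weight (tree n l) f ℤ.≤ 0ℤ
  upperBound f bdf with IsBDF.values bdf root
  ... | inj₁ r≡-1        = contradiction (rootNegative⇒halfTwos bdf r≡-1) ¬half
  ... | inj₂ (inj₁ r≡0) rewrite weight-BDF bdf | r≡0 | ℤ.*-zeroʳ (+ n) = ℤ.≤-refl
  ... | inj₂ (inj₂ r≡1) rewrite weight-BDF bdf | r≡1 | ℤ.*-identityʳ (+ n) =
    ℤ.i≤j⇒i-j≤0 (ℤ.+≤+ n≥1)

-- The BDF `extremal l` has weight n - 1, which is positive and so exceeds the supposed maximum 0.
halfTwos⇒¬dBalanced : ∀ {n} {l : Fin n → ℕ} → n ≥ 2 → HalfTwos n l → ¬ DBalanced (tree n l)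
halfTwos⇒¬dBalanced {n} {l} n≥2 half dBalanced =
  ℕ.<⇒≱ n≥2 (ℤ.drop‿+≤+ (ℤ.i-j≤0⇒i≤j (subst (ℤ._≤ 0ℤ) weight-extremal
    (IsBalancedDominationNumber.upperBound dBalanced (extremal l) (extremal-isBDF half)))))
  where
  weight-extremal : weight (tree n l) (extremal l) ≡ + n - 1ℤ
  weight-extremal = trans (weight-BDF (extremal-isBDF half)) (rearrange (+ n))
    where
    rearrange : ∀ m → -1ℤ - m * -1ℤ ≡ m - 1ℤ
    rearrange = solve-∀

theorem4 : (n : ℕ) → n ≥ 2 → (l : Fin n → ℕ) →
    (¬ DBalanced (tree n l)) ⇔
    (((+ #twos l) / 1 ≃ (+ n - + 1) / 2) × (∀ i → l i ≡ 0 ⊎ l i ≡ 2))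
theorem4 n n≥2 l = mk⇔
  -- Contraposition yields only the double negation of `HalfTwos n l`; decidability removes it
  -- constructively.
  (λ ¬dBalanced → decidable-stable (halfTwos? n l)
    (¬dBalanced ∘ ¬halfTwos⇒dBalanced (ℕ.<⇒≤ n≥2)))
  (halfTwos⇒¬dBalanced n≥2)
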